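{- If $E$ is a regular, locally finite equational theory over the signature $\Sigma$, then $E$ is Noetherian w.r.t. the unrestricted instantiation preorder, i.e., every strictly descending chain of substitutions $\sigma_1>_E^V\sigma_2>_E^V\sigma_3>_E^V\cdots$ is finite.
   Context: $\Sigma$ is a finite signature, $V$ a countably infinite set of variables, $T(\Sigma,X)$ the set of terms over $\Sigma$ with variables in $X$, and $\mathrm{Var}(t)$ the set of variables occurring in $t$. An equational theory $E$ is a set of (implicitly universally quantified) identities between terms in $T(\Sigma,V)$, and $\approx_E$ is the congruence relation on $T(\Sigma,V)$ it induces ($s\approx_E t$ iff $s\approx t$ holds in all models of $E$). All equational theories are assumed to be non-trivial: $x\approx_E y$ does not hold for distinct variables $x,y$. $E$ is regular if $\mathrm{Var}(s)=\mathrm{Var}(t)$ for all identities $s\approx t$ in $E$. $E$ is locally finite if for every finite $X\subseteq V$ the set $\{[t]_{\approx_E}\mid t\in T(\Sigma,X)\}$ of $\approx_E$-equivalence classes is finite. A substitution is a map $\sigma:V\to T(\Sigma,V)$ with finite domain $\{x\in V\mid\sigma(x)\neq x\}$, extended homomorphically to terms. The unrestricted instantiation preorder is defined by: $\sigma\leq_E^V\tau$ iff there is a substitution $\lambda$ with $\lambda(\sigma(x))\approx_E\tau(x)$ for all $x\in V$. We write $\sigma<_E^V\tau$ (equivalently $\tau>_E^V\sigma$) if $\sigma\leq_E^V\tau$ and not $\tau\leq_E^V\sigma$. -}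

module Defs where

open import Data.Fin.Base using (Fin)
open import Data.List.Base using (List)
open import Data.List.Membership.Propositional using (_∈_)
import Data.List.Relation.Unary.Enumerates.Setoid as Enumerates
open import Data.Nat.Base using (ℕ)
open import Data.Product.Base using (Σ; ∃; _×_; proj₁)
open import Data.Vec.Base using (Vec; []; _∷_)
open import Data.Vec.Relation.Binary.Pointwise.Inductive using (Pointwise)
open import Data.Vec.Relation.Unary.Any using (Any)
open import Function.Bundles using (_⇔_; _↔_)
open import Induction.InfiniteDescent using (InfiniteDescendingSequence)
open import Level using (0ℓ; suc)
open import Relation.Binary.Bundles using (Setoid)
open import Relation.Binary.Core using (Rel)
open import Relation.Binary.PropositionalEquality.Core using (_≢_)
open import Relation.Nullary.Negation.Core using (¬_)

record FiniteSignature : Set₁ where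
  field
    Op     : Set
    arity  : Op → ℕ
    size   : ℕ
    finite : Op ↔ Fin size

open FiniteSignature

data Term (S : FiniteSignature) (V : Set) : Set where
  var  : V → Term S V
  node : (f : Op S) → Vec (Term S V) (arity S f) → Term S V

-- Sets of identities: E s t means that s ≈ t belongs to E.
Identities : FiniteSignature → Set → Set₁
Identities S V = Rel (Term S V) 0ℓ

-- Algebras are carried by setoids, the equality of the algebra being _≈_;
-- this is what allows quotients of term algebras to be algebras.
record Algebra (S : FiniteSignature) : Set₁ where
  field
    setoid : Setoid 0ℓ 0ℓ
  open Setoid setoid public
  field
    op      : (f : Op S) → Vec Carrier (arity S f) → Carrier
    op-cong : ∀ f {as bs} → Pointwise _≈_ as bs → op f as ≈ op f bs

module _ {S : FiniteSignature} {V : Set} where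

  data _∈Var_ (x : V) : Term S V → Set where
    here  : x ∈Var var x
    there : ∀ {f ts} → Any (x ∈Var_) ts → x ∈Var node f ts

  module _ (A : Algebra S) (ρ : V → Algebra.Carrier A) where
    mutual
      eval : Term S V → Algebra.Carrier A
      eval (var x)     = ρ x
      eval (node f ts) = Algebra.op A f (evals ts)

      evals : ∀ {n} → Vec (Term S V) n → Vec (Algebra.Carrier A) n
      evals []       = []
      evals (t ∷ ts) = eval t ∷ evals ts

  _⊨_≋_ : Algebra S → Term S V → Term S V → Set
  A ⊨ s ≋ t = ∀ ρ → Algebra._≈_ A (eval A ρ s) (eval A ρ t)

  IsModel : Identities S V → Algebra S → Set
  IsModel E A = ∀ s t → E s t → A ⊨ s ≋ t

  _⊢_≈_ : Identities S V → Term S V → Term S V → Set₁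
  E ⊢ s ≈ t = ∀ A → IsModel E A → A ⊨ s ≋ t

  NonTrivial : Identities S V → Set₁
  NonTrivial E = ∀ x y → x ≢ y → ¬ (E ⊢ var x ≈ var y)

  Regular : Identities S V → Set
  Regular E = ∀ s t → E s t → ∀ x → x ∈Var s ⇔ x ∈Var t

  -- T(Σ,X) for the finite set X of variables listed by xs.
  TermOver : List V → Set
  TermOver xs = Σ (Term S V) λ t → ∀ x → x ∈Var t → x ∈ xs

  -- The quotient { [t] | t ∈ T(Σ,X) }, as a setoid.
  classes : Identities S V → List V → Setoid 0ℓ (suc 0ℓ)
  classes E xs = record
    { Carrier       = TermOver xs
    ; _≈_           = λ s t → E ⊢ proj₁ s ≈ proj₁ t
    ; isEquivalence = record
      { refl  = λ A _ _ → Algebra.refl A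
      ; sym   = λ p A m ρ → Algebra.sym A (p A m ρ)
      ; trans = λ p q A m ρ → Algebra.trans A (p A m ρ) (q A m ρ)
      }
    }

  LocallyFinite : Identities S V → Set₁
  LocallyFinite E = ∀ xs → ∃ (Enumerates.IsEnumeration (classes E xs))

-- The list witnesses finiteness of the domain { x | σ(x) ≠ x }: it has to
-- contain the domain, but may be larger. Nothing below depends on its choice.
record Substitution (S : FiniteSignature) (V : Set) : Set where
  field
    map          : V → Term S V
    support      : List V
    finiteDomain : ∀ x → map x ≢ var x → x ∈ support

module _ {S : FiniteSignature} {V : Set} where

  open Substitution

  mutual
    apply : Substitution S V → Term S V → Term S V
    apply σ (var x)     = map σ x
    apply σ (node f ts) = node f (applys σ ts)

    applys : ∀ {n} → Substitution S V → Vec (Term S V) n → Vec (Term S V) n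
    applys σ []       = []
    applys σ (t ∷ ts) = apply σ t ∷ applys σ ts

  InstPreorder : Identities S V → Rel (Substitution S V) (suc 0ℓ)
  InstPreorder E σ τ = ∃ λ l → ∀ x → E ⊢ apply l (map σ x) ≈ map τ x

  StrictInst : Identities S V → Rel (Substitution S V) (suc 0ℓ)
  StrictInst E σ τ = InstPreorder E σ τ × ¬ InstPreorder E τ σ

  Noetherian : Identities S V → Set₁
  Noetherian E = ¬ ∃ (InfiniteDescendingSequence (StrictInst E))

{-# OPTIONS --safe #-}

-- Fix a strictly descending chain of substitutions σₖ. As λₖ σₖ ≈ σ₀, where
-- σ₀ fixes all variables x outside a finite set X, regularity gives a variable
-- of σₖ(x) that λₖ maps to a term whose only variable is x. Renaming it to x
-- makes σₖ equivalent to a substitution with Var(σₖ(x)) ⊆ X ∪ {x} for all x.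
-- By local finiteness, σₖ(x) then has one of finitely many "colours": its class,
-- with x replaced by a placeholder.
--
-- A Ramsey-type argument provides i < k and a finite set B ⊇ X such that σᵢ and
-- σₖ have the same colours on B and there is an injection f, preserving colours,
-- from the variables outside B moved by σᵢ to variables outside B fixed by σᵢ.
-- Let λ σₖ ≈ σᵢ, and let θ(f(x)) = σₖ(x), θ being the identity elsewhere. For x
-- outside B moved by σᵢ, θ λ maps σₖ(f(x)) to θ(f(x)) = σₖ(x), and σᵢ(x) is a
-- copy of σₖ(f(x)). Hence λ′ with λ′ = θ λ on B, λ′(x) = θ(λ(f(x))) for these x,
-- and λ′(x) = σₖ(x) for all others satisfies λ′ σᵢ ≈ σₖ, contradicting strictness.
module Submission where

open import Defs
open import Data.Bool.Base using (Bool; true; false; _∨_)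
open import Data.Bool.Properties using (∨-zeroʳ; ⇔→≡)
open import Data.Fin.Base using (Fin; zero; suc)
open import Data.Fin.Properties using (¬∀⟶∃¬) renaming (_≟_ to _≟ᶠ_)
import Data.List.Base as List
open import Data.List.Base using (List; []; _∷_; length; filter; upTo)
open import Data.List.Membership.Propositional using (_∈_)
open import Data.List.Membership.Propositional.Properties
  using (∈-filter⁺; ∈-filter⁻; ∈-map⁺; ∈-upTo⁺; ∈-upTo⁻)
open import Data.List.Relation.Binary.Sublist.Propositional using (⊆-refl)
open import Data.List.Relation.Binary.Sublist.Propositional.Properties
  using (filter⁺; length-mono-≤)
import Data.List.Relation.Unary.All as All
open import Data.List.Relation.Unary.AllPairs using (_∷_)
import Data.List.Relation.Unary.Any as ListAny
open import Data.List.Relation.Unary.Any.Properties using (lookup-index)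
open import Data.List.Relation.Unary.Unique.Propositional using (Unique)
import Data.List.Relation.Unary.Unique.Propositional.Properties as Uniqueₚ
open import Data.Nat.Base
  using (ℕ; zero; suc; _≤_; _<_; _⊔_; z≤n; s≤s; s≤s⁻¹; _≤′_; ≤′-refl; ≤′-step)
open import Data.Nat.Properties
  using (_≤?_; ≤-refl; ≤-reflexive; ≤-trans; <-≤-trans; <-irrefl; <⇒≤; <⇒≱; ≰⇒>; n≮0
        ; n≤1+n; m≤m⊔n; m≤n⊔m; m⊔n≤o⇒m≤o; m⊔n≤o⇒n≤o; m<1+n⇒m<n∨m≡n; ≤∧≢⇒<; ≤⇒≤′)
  renaming (_≟_ to _≟ℕ_)
open import Data.Product.Base using (∃; ∃₂; _×_; _,_; proj₁; proj₂)
open import Data.Sum.Base using (_⊎_; inj₁; inj₂; [_,_]′)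
open import Data.Vec.Base using (Vec; []; _∷_; foldr′)
open import Data.Vec.Relation.Binary.Pointwise.Inductive using (Pointwise; []; _∷_)
open import Data.Vec.Relation.Unary.Any using (Any; here; there)
open import Function.Base using (_∘_)
open import Function.Bundles using (_↔_; mk⇔; Equivalence; Inverse)
open import Level using (0ℓ) renaming (suc to lsuc)
open import Relation.Binary.Bundles using (Setoid)
open import Relation.Binary.Definitions using (DecidableEquality)
open import Relation.Binary.PropositionalEquality
  using (_≡_; _≢_; refl; sym; trans; cong; cong₂; subst; subst₂; setoid)
import Relation.Binary.Reasoning.Setoid as ≈-Reasoning
open import Relation.Nullary.Decidable
  using (Dec; yes; no; does; map′; _×-dec_; dec-true; decidable-stable)
open import Relation.Nullary.Negation using (¬_; contradiction)
open import Relation.Unary using (Pred; _⊆_)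

open Substitution

-- Infinite sets of natural numbers

-- Unboundedness is stated under a double negation: the theorem is itself a negation, so classical
-- case distinctions can be made inside `¬ ¬`.
Infinite : Pred ℕ 0ℓ → Set
Infinite P = ∀ m → ¬ ¬ ∃ λ k → m ≤ k × P k

Infinite-mono : ∀ {P Q} → P ⊆ Q → Infinite P → Infinite Q
Infinite-mono P⊆Q inf m ¬Q = inf m λ (k , m≤k , p) → ¬Q (k , m≤k , P⊆Q p)

Infinite-above : ∀ {P} i → Infinite P → Infinite (λ k → i < k × P k)
Infinite-above i inf m ¬Q = inf (m ⊔ suc i) λ (k , m⊔i<k , p) →
  ¬Q (k , ≤-trans (m≤m⊔n m (suc i)) m⊔i<k , ≤-trans (m≤n⊔m m (suc i)) m⊔i<k , p)

finite-bound : ∀ {P} → ¬ Infinite P → ¬ ¬ ∃ λ m → ∀ k → m ≤ k → ¬ P k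
finite-bound fin ¬bound = fin λ m ¬P → ¬bound (m , λ k m≤k p → ¬P (k , m≤k , p))

-- Either `Q zero` is infinite, or it is bounded by some `m`, and beyond `m` the other `n` sets
-- cover `P`.
pigeonhole : ∀ {P} n (Q : Fin n → Pred ℕ 0ℓ) → Infinite P →
             (∀ {k} → P k → ∃ λ c → Q c k) → ¬ ¬ ∃ λ c → Infinite (Q c)
pigeonhole zero    Q inf cover ¬Q = inf 0 λ { (_ , _ , p) → contradiction (proj₁ (cover p)) λ () }
pigeonhole {P} (suc n) Q inf cover ¬Q =
  finite-bound {Q zero} (λ inf₀ → ¬Q (zero , inf₀)) λ (m , ¬Q₀) →
  pigeonhole n (Q ∘ suc) (Infinite-above m inf) (cover′ m ¬Q₀)
    λ (c , infc) → ¬Q (suc c , infc)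
  where
  cover′ : ∀ m → (∀ k → m ≤ k → ¬ Q zero k) →
           ∀ {k} → m < k × P k → ∃ λ c → Q (suc c) k
  cover′ m ¬Q₀ (m<k , p) with cover p
  ... | zero  , q = contradiction q (¬Q₀ _ (<⇒≤ m<k))
  ... | suc c , q = c , q

-- This is what makes room for injections: however far out `b′` is chosen, almost every `k` still
-- counts at least as much beyond `b′` as `i` does beyond `b`.
Settled : (ℕ → ℕ → ℕ) → Pred ℕ 0ℓ → ℕ → Set
Settled count P b =
  ∀ i → P i → ∀ b′ → ¬ Infinite (λ k → P k × count k b′ < count i b)

-- The least m such that count k b < m for some b and infinitely many k
-- cannot be lowered by enlarging b.
settle-bounded : ∀ count m b {P} → Infinite P → (∀ {k} → P k → count k b < m) →
                 ¬ ¬ ∃₂ λ P′ b′ → Infinite P′ × P′ ⊆ P × Settled count P′ b′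
settle-bounded count zero    b inf small ¬S = inf 0 λ (_ , _ , p) → n≮0 (small p)
settle-bounded count (suc m) b {P} inf small ¬S =
  ¬S (P , b , inf , (λ p → p) , λ i pi b′ inf′ →
    settle-bounded count m b′
      (Infinite-mono (λ (p , lt) → p , <-≤-trans lt (s≤s⁻¹ (small pi))) inf′)
      proj₂
      λ (P′ , b″ , inf″ , P′⊆ , settled) → ¬S (P′ , b″ , inf″ , proj₁ ∘ P′⊆ , settled))

settle : ∀ count {P} → Infinite P →
         ¬ ¬ ∃₂ λ P′ b′ → Infinite P′ × P′ ⊆ P × Settled count P′ b′
settle count {P} inf ¬S =
  -- If `P` is not settled at `0`, the offending `i` supplies the bound `count i 0` from which the
  -- descent starts.
  ¬S (P , 0 , inf , (λ p → p) , λ i pi b′ inf′ →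
    settle-bounded count (count i 0) b′ inf′ proj₂
      λ (P′ , b″ , inf″ , P′⊆ , settled) → ¬S (P′ , b″ , inf″ , proj₁ ∘ P′⊆ , settled))

Antitone : (ℕ → ℕ → ℕ) → Set
Antitone count = ∀ k {b b′} → b ≤ b′ → count k b′ ≤ count k b

-- Shrinking `P` leaves fewer `k`, and raising `b` lowers the threshold `count i b`. So a colour
-- once settled stays settled while the others are treated.
Settled-mono : ∀ {count P P′ b b′} → Antitone count → P′ ⊆ P → b ≤ b′ →
               Settled count P b → Settled count P′ b′
Settled-mono anti P′⊆P b≤b′ settled i p′i d inf =
  settled i (P′⊆P p′i) d
    (Infinite-mono (λ (p , lt) → P′⊆P p , <-≤-trans lt (anti i b≤b′)) inf)

settle-all : ∀ N (count : Fin N → ℕ → ℕ → ℕ) → (∀ τ → Antitone (count τ)) →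
             ∀ b {P} → Infinite P →
             ¬ ¬ ∃₂ λ P′ b′ → Infinite P′ × b ≤ b′ × (∀ τ → Settled (count τ) P′ b′)
settle-all zero    count anti b {P} inf ¬S = ¬S (P , b , inf , ≤-refl , λ ())
settle-all (suc N) count anti b inf ¬S =
  settle-all N (count ∘ suc) (anti ∘ suc) b inf λ (P₁ , b₁ , inf₁ , b≤b₁ , settled₁) →
  settle (count zero) inf₁ λ (P₂ , b₂ , inf₂ , P₂⊆P₁ , settled₂) →
  ¬S (P₂ , b₁ ⊔ b₂ , inf₂ , ≤-trans b≤b₁ (m≤m⊔n b₁ b₂) , λ
    { zero    → Settled-mono (anti zero) (λ p → p) (m≤n⊔m b₁ b₂) settled₂
    ; (suc τ) → Settled-mono (anti (suc τ)) P₂⊆P₁ (m≤m⊔n b₁ b₂) (settled₁ τ) })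

AgreeBelow : ∀ {N} → (ℕ → ℕ → Fin N) → ℕ → ℕ → ℕ → Set
AgreeBelow c b i k = ∀ x → x < b → c i x ≡ c k x

-- One use of `pigeonhole` for each of the finitely many positions below `b`.
agreeing : ∀ {N} (c : ℕ → ℕ → Fin N) b {P} → Infinite P →
           ¬ ¬ ∃ λ P′ → Infinite P′ × P′ ⊆ P × (∀ {i k} → P′ i → P′ k → AgreeBelow c b i k)
agreeing c zero {P} inf ¬A = ¬A (P , inf , (λ p → p) , λ _ _ _ ())
agreeing {N} c (suc b) inf ¬A =
  agreeing c b inf λ (P′ , inf′ , P′⊆P , agree) →
  pigeonhole N (λ τ k → P′ k × c k b ≡ τ) inf′ (λ p → _ , p , refl) λ (τ , infτ) →
  ¬A (_ , infτ , P′⊆P ∘ proj₁ , λ (pi , eqi) (pk , eqk) x x<1+b →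
    case-< agree pi pk eqi eqk (m<1+n⇒m<n∨m≡n x<1+b))
  where
  case-< : ∀ {P′ : Pred ℕ 0ℓ} {i k x τ} → (∀ {i k} → P′ i → P′ k → AgreeBelow c b i k) →
           P′ i → P′ k → c i b ≡ τ → c k b ≡ τ → x < b ⊎ x ≡ b → c i x ≡ c k x
  case-< agree pi pk eqi eqk (inj₁ x<b)  = agree pi pk _ x<b
  case-< agree pi pk eqi eqk (inj₂ refl) = trans eqi (sym eqk)

-- Colourings of the natural numbers

module _ {N} (c : ℕ → Fin N) (ℓ : ℕ) where

  occurs? : ∀ τ b x → Dec (b ≤ x × c x ≡ τ)
  occurs? τ b x = (b ≤? x) ×-dec (c x ≟ᶠ τ)

  occurrences : Fin N → ℕ → List ℕ
  occurrences τ b = filter (occurs? τ b) (upTo ℓ)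

  ∈-occurrences⁺ : ∀ {τ b x} → b ≤ x → x < ℓ → c x ≡ τ → x ∈ occurrences τ b
  ∈-occurrences⁺ {τ} {b} b≤x x<ℓ cx≡τ = ∈-filter⁺ (occurs? τ b) (∈-upTo⁺ x<ℓ) (b≤x , cx≡τ)

  ∈-occurrences⁻ : ∀ {τ b x} → x ∈ occurrences τ b → b ≤ x × x < ℓ × c x ≡ τ
  ∈-occurrences⁻ {τ} {b} x∈ =
    let x∈upTo , b≤x , cx≡τ = ∈-filter⁻ (occurs? τ b) x∈ in b≤x , ∈-upTo⁻ x∈upTo , cx≡τ

  occurrences-unique : ∀ τ b → Unique (occurrences τ b)
  occurrences-unique τ b = Uniqueₚ.filter⁺ (occurs? τ b) (Uniqueₚ.upTo⁺ ℓ)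

  occurrences-antitone : ∀ τ {b b′} → b ≤ b′ →
                         length (occurrences τ b′) ≤ length (occurrences τ b)
  occurrences-antitone τ {b} {b′} b≤b′ = length-mono-≤
    (filter⁺ (occurs? τ b′) (occurs? τ b) (λ { refl (b′≤x , eq) → ≤-trans b≤b′ b′≤x , eq })
      (⊆-refl {x = upTo ℓ}))

-- An injection given with a left inverse, since a variable must later be recovered from its image.
Matching : List ℕ → List ℕ → Set
Matching as bs = ∃₂ λ (f g : ℕ → ℕ) → ∀ {x} → x ∈ as → f x ∈ bs × g (f x) ≡ x

update : ℕ → ℕ → (ℕ → ℕ) → ℕ → ℕ
update a b f x with x ≟ℕ a
... | yes _ = b
... | no  _ = f x

update-≡ : ∀ a b f → update a b f a ≡ b
update-≡ a b f with a ≟ℕ a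
... | yes _   = refl
... | no  a≢a = contradiction refl a≢a

update-≢ : ∀ {a} b f {x} → x ≢ a → update a b f x ≡ f x
update-≢ {a} b f {x} x≢a with x ≟ℕ a
... | yes x≡a = contradiction x≡a x≢a
... | no  _   = refl

matching : ∀ as bs → Unique as → Unique bs → length as ≤ length bs → Matching as bs
matching []       bs       _          _          _        = (λ x → x) , (λ x → x) , λ ()
matching (a ∷ as) (b ∷ bs) (a∉ ∷ as!) (b∉ ∷ bs!) (s≤s le) =
  let f , g , match = matching as bs as! bs! le in
  update a b f , update b a g , λ
    { (ListAny.here refl) → subst (λ y → y ∈ b ∷ bs × update b a g y ≡ a) (sym (update-≡ a b f))
                      (ListAny.here refl , update-≡ b a g)
    ; {x} (ListAny.there x∈) →
        let fx∈ , gfx≡x = match x∈ in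
        subst (λ y → y ∈ b ∷ bs × update b a g y ≡ x)
          (sym (update-≢ b f λ { refl → All.lookup a∉ x∈ refl }))
          (ListAny.there fx∈ , trans (update-≢ a g λ { refl → All.lookup b∉ fx∈ refl }) gfx≡x)
    }

-- Here `c` and `c′` are the colourings of σᵢ and σₖ, which fix the codes from `ℓ` and `ℓ′` on. The
-- bound `b ⊔ ℓ` in `to-lower` puts images outside B and among the variables fixed by σᵢ.
record Transfer {N} (n : ℕ) (c : ℕ → Fin N) (ℓ : ℕ) (c′ : ℕ → Fin N) (ℓ′ : ℕ) : Set where
  field
    b         : ℕ
    n≤b       : n ≤ b
    agree     : ∀ x → x < b → c x ≡ c′ x
    to from   : ℕ → ℕ
    to-lower  : ∀ {x} → b ≤ x → x < ℓ → b ⊔ ℓ ≤ to x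
    to-upper  : ∀ {x} → b ≤ x → x < ℓ → to x < ℓ′
    to-colour : ∀ {x} → b ≤ x → x < ℓ → c′ (to x) ≡ c x
    from-to   : ∀ {x} → b ≤ x → x < ℓ → from (to x) ≡ x

transfer : ∀ {N} n b (c : ℕ → Fin N) ℓ c′ ℓ′ → n ≤ b → (∀ x → x < b → c x ≡ c′ x) →
           (∀ τ → length (occurrences c ℓ τ b) ≤ length (occurrences c′ ℓ′ τ (b ⊔ ℓ))) →
           Transfer n c ℓ c′ ℓ′
transfer n b c ℓ c′ ℓ′ n≤b agree fits = record
  { b         = b
  ; n≤b       = n≤b
  ; agree     = agree
  ; to        = to
  ; from      = from
  ; to-lower  = λ b≤x x<ℓ → proj₁ (to-occurs b≤x x<ℓ)
  ; to-upper  = λ b≤x x<ℓ → proj₁ (proj₂ (to-occurs b≤x x<ℓ))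
  ; to-colour = λ b≤x x<ℓ → proj₂ (proj₂ (to-occurs b≤x x<ℓ))
  ; from-to   = λ {x} b≤x x<ℓ →
      -- `from` selects the matching by the colour of its argument; as `to` preserves colours, this
      -- is the matching that `to` used.
      trans (cong (λ τ → proj₁ (proj₂ (m τ)) (to x)) (proj₂ (proj₂ (to-occurs b≤x x<ℓ))))
            (proj₂ (matched b≤x x<ℓ))
  }
  where
  m : ∀ τ → Matching (occurrences c ℓ τ b) (occurrences c′ ℓ′ τ (b ⊔ ℓ))
  m τ = matching _ _ (occurrences-unique c ℓ τ b) (occurrences-unique c′ ℓ′ τ (b ⊔ ℓ)) (fits τ)

  to from : ℕ → ℕ
  to x   = proj₁ (m (c x)) x
  from y = proj₁ (proj₂ (m (c′ y))) y

  matched : ∀ {x} → b ≤ x → x < ℓ →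
            to x ∈ occurrences c′ ℓ′ (c x) (b ⊔ ℓ) × proj₁ (proj₂ (m (c x))) (to x) ≡ x
  matched {x} b≤x x<ℓ = proj₂ (proj₂ (m (c x))) (∈-occurrences⁺ c ℓ b≤x x<ℓ refl)

  to-occurs : ∀ {x} → b ≤ x → x < ℓ → b ⊔ ℓ ≤ to x × to x < ℓ′ × c′ (to x) ≡ c x
  to-occurs b≤x x<ℓ = ∈-occurrences⁻ c′ ℓ′ (proj₁ (matched b≤x x<ℓ))

-- Fix `i` in the final set. If no later `k` were suitable, each would lack room for some colour
-- `τ`; a single `τ` would then fail for infinitely many `k`, which `Settled` forbids at `b ⊔ ℓ i`.
transferable-pair : ∀ {N} n (c : ℕ → ℕ → Fin N) (ℓ : ℕ → ℕ) →
                    ¬ ¬ ∃₂ λ i k → i < k × Transfer n (c i) (ℓ i) (c k) (ℓ k)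
transferable-pair {N} n c ℓ ¬pair =
  settle-all N count (λ τ k → occurrences-antitone (c k) (ℓ k) τ) n everything
    λ (P₁ , b , inf₁ , n≤b , settled) →
  agreeing c b inf₁ λ (P , inf , P⊆P₁ , agree) →
  inf 0 λ (i , _ , pi) →
  pigeonhole N (λ τ k → P₁ k × count τ k (b ⊔ ℓ i) < count τ i b)
    (Infinite-above i inf)
    (λ {k} (i<k , pk) →
      let τ , ≰ = ¬∀⟶∃¬ N (λ τ → count τ i b ≤ count τ k (b ⊔ ℓ i)) (λ τ → _ ≤? _)
                    (λ fits → ¬pair (i , k , i<k ,
                      transfer n b (c i) (ℓ i) (c k) (ℓ k) n≤b (agree pi pk) fits))
      in τ , P⊆P₁ pk , ≰⇒> ≰)
    λ (τ , infτ) → settled τ i (P⊆P₁ pi) (b ⊔ ℓ i) infτ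
  where
  count : Fin N → ℕ → ℕ → ℕ
  count τ k b = length (occurrences (c k) (ℓ k) τ b)

  everything : Infinite (λ _ → ℕ)
  everything m ¬∃ = ¬∃ (m , ≤-refl , m)

-- Terms and validity

module _ {S : FiniteSignature} {V : Set} where

  mutual
    -- Substitution along an arbitrary map, so that auxiliary maps can be composed freely and
    -- finiteness of the domain is treated separately.
    bind : (V → Term S V) → Term S V → Term S V
    bind m (var x)     = m x
    bind m (node f ts) = node f (binds m ts)

    binds : ∀ {n} → (V → Term S V) → Vec (Term S V) n → Vec (Term S V) n
    binds m []       = []
    binds m (t ∷ ts) = bind m t ∷ binds m ts

  mutual
    apply≡bind : ∀ σ (t : Term S V) → apply σ t ≡ bind (map σ) t
    apply≡bind σ (var x)     = refl
    apply≡bind σ (node f ts) = cong (node f) (applys≡binds σ ts)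

    applys≡binds : ∀ {n} σ (ts : Vec (Term S V) n) → applys σ ts ≡ binds (map σ) ts
    applys≡binds σ []       = refl
    applys≡binds σ (t ∷ ts) = cong₂ _∷_ (apply≡bind σ t) (applys≡binds σ ts)

  mutual
    bind-bind : ∀ m l (t : Term S V) → bind m (bind l t) ≡ bind (bind m ∘ l) t
    bind-bind m l (var x)     = refl
    bind-bind m l (node f ts) = cong (node f) (binds-binds m l ts)

    binds-binds : ∀ {n} m l (ts : Vec (Term S V) n) →
                  binds m (binds l ts) ≡ binds (bind m ∘ l) ts
    binds-binds m l []       = refl
    binds-binds m l (t ∷ ts) = cong₂ _∷_ (bind-bind m l t) (binds-binds m l ts)

  mutual
    bind-local : ∀ {m l} (t : Term S V) → (∀ {x} → x ∈Var t → m x ≡ l x) → bind m t ≡ bind l t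
    bind-local (var x)     eq = eq here
    bind-local (node f ts) eq = cong (node f) (binds-local ts (eq ∘ there))

    binds-local : ∀ {n m l} (ts : Vec (Term S V) n) →
                  (∀ {x} → Any (x ∈Var_) ts → m x ≡ l x) → binds m ts ≡ binds l ts
    binds-local []       eq = refl
    binds-local (t ∷ ts) eq = cong₂ _∷_ (bind-local t (eq ∘ here)) (binds-local ts (eq ∘ there))

  mutual
    bind-var : (t : Term S V) → bind var t ≡ t
    bind-var (var x)     = refl
    bind-var (node f ts) = cong (node f) (binds-var ts)

    binds-var : ∀ {n} (ts : Vec (Term S V) n) → binds var ts ≡ ts
    binds-var []       = refl
    binds-var (t ∷ ts) = cong₂ _∷_ (bind-var t) (binds-var ts)

  bind-fixes : ∀ {m} (t : Term S V) → (∀ {x} → x ∈Var t → m x ≡ var x) → bind m t ≡ t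
  bind-fixes t eq = trans (bind-local t eq) (bind-var t)

  mutual
    ∈Var-bind⁺ : ∀ {m x y} {t : Term S V} → x ∈Var t → y ∈Var m x → y ∈Var bind m t
    ∈Var-bind⁺ here       y∈ = y∈
    ∈Var-bind⁺ (there x∈) y∈ = there (∈Var-binds⁺ x∈ y∈)

    ∈Var-binds⁺ : ∀ {n m x y} {ts : Vec (Term S V) n} →
                  Any (x ∈Var_) ts → y ∈Var m x → Any (y ∈Var_) (binds m ts)
    ∈Var-binds⁺ (here x∈)  y∈ = here (∈Var-bind⁺ x∈ y∈)
    ∈Var-binds⁺ (there x∈) y∈ = there (∈Var-binds⁺ x∈ y∈)

  mutual
    ∈Var-bind⁻ : ∀ {m y} (t : Term S V) → y ∈Var bind m t → ∃ λ x → x ∈Var t × y ∈Var m x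
    ∈Var-bind⁻ (var x)     y∈         = x , here , y∈
    ∈Var-bind⁻ (node f ts) (there y∈) =
      let x , x∈ , y∈mx = ∈Var-binds⁻ ts y∈ in x , there x∈ , y∈mx

    ∈Var-binds⁻ : ∀ {n m y} (ts : Vec (Term S V) n) → Any (y ∈Var_) (binds m ts) →
                  ∃ λ x → Any (x ∈Var_) ts × y ∈Var m x
    ∈Var-binds⁻ (t ∷ ts) (here y∈)  =
      let x , x∈ , y∈mx = ∈Var-bind⁻ t y∈ in x , here x∈ , y∈mx
    ∈Var-binds⁻ (t ∷ ts) (there y∈) =
      let x , x∈ , y∈mx = ∈Var-binds⁻ ts y∈ in x , there x∈ , y∈mx

  module _ (A : Algebra S) where
    private module A = Algebra A

    mutual
      eval-bind : ∀ ρ m (t : Term S V) → eval A ρ (bind m t) ≡ eval A (eval A ρ ∘ m) t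
      eval-bind ρ m (var x)     = refl
      eval-bind ρ m (node f ts) = cong (A.op f) (evals-binds ρ m ts)

      evals-binds : ∀ {n} ρ m (ts : Vec (Term S V) n) →
                    evals A ρ (binds m ts) ≡ evals A (eval A ρ ∘ m) ts
      evals-binds ρ m []       = refl
      evals-binds ρ m (t ∷ ts) = cong₂ _∷_ (eval-bind ρ m t) (evals-binds ρ m ts)

-- Occurrence of variables under regular theories

occurrenceAlgebra : (S : FiniteSignature) → Algebra S
occurrenceAlgebra S = record
  { setoid  = setoid Bool
  -- Every symbol is read as a disjunction, constants as `false`; a term is true exactly when one of
  -- its variables is.
  ; op      = λ _ → or
  ; op-cong = λ _ → or-cong
  }
  where
  or : ∀ {n} → Vec Bool n → Bool
  or = foldr′ _∨_ false

  or-cong : ∀ {n} {as bs : Vec Bool n} → Pointwise _≡_ as bs → or as ≡ or bs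
  or-cong []         = refl
  or-cong (eq ∷ eqs) = cong₂ _∨_ eq (or-cong eqs)

module _ {S : FiniteSignature} {V : Set} (ρ : V → Bool) where

  private
    truth : Term S V → Bool
    truth = eval (occurrenceAlgebra S) ρ

    truths : ∀ {n} → Vec (Term S V) n → Vec Bool n
    truths = evals (occurrenceAlgebra S) ρ

  mutual
    occurrence⁺ : ∀ {x t} → x ∈Var t → ρ x ≡ true → truth t ≡ true
    occurrence⁺ here       ρx = ρx
    occurrence⁺ (there x∈) ρx = occurrences⁺ x∈ ρx

    occurrences⁺ : ∀ {n x} {ts : Vec (Term S V) n} → Any (x ∈Var_) ts → ρ x ≡ true →
                   foldr′ _∨_ false (truths ts) ≡ true
    occurrences⁺ {ts = t ∷ ts} (here x∈)  ρx rewrite occurrence⁺ x∈ ρx  = refl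
    occurrences⁺ {ts = t ∷ ts} (there x∈) ρx rewrite occurrences⁺ x∈ ρx = ∨-zeroʳ (truth t)

  mutual
    occurrence⁻ : ∀ t → truth t ≡ true → ∃ λ x → x ∈Var t × ρ x ≡ true
    occurrence⁻ (var x)     eq = x , here , eq
    occurrence⁻ (node f ts) eq = let x , x∈ , ρx = occurrences⁻ ts eq in x , there x∈ , ρx

    occurrences⁻ : ∀ {n} (ts : Vec (Term S V) n) → foldr′ _∨_ false (truths ts) ≡ true →
                   ∃ λ x → Any (x ∈Var_) ts × ρ x ≡ true
    occurrences⁻ (t ∷ ts) eq with truth t in eqₜ
    ... | true  = let x , x∈ , ρx = occurrence⁻ t eqₜ in x , here x∈ , ρx
    ... | false = let x , x∈ , ρx = occurrences⁻ ts eq in x , there x∈ , ρx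

module _ {S : FiniteSignature} {V : Set} {E : Identities S V} where

  occurrenceAlgebra-model : Regular E → IsModel E (occurrenceAlgebra S)
  occurrenceAlgebra-model regular s t s≈t ρ = ⇔→≡ (mk⇔
    (λ eq → let x , x∈ , ρx = occurrence⁻ ρ s eq in
            occurrence⁺ ρ (Equivalence.to (regular s t s≈t x) x∈) ρx)
    (λ eq → let x , x∈ , ρx = occurrence⁻ ρ t eq in
            occurrence⁺ ρ (Equivalence.from (regular s t s≈t x) x∈) ρx))

  -- Validity is semantic, so one model suffices: in the algebra of disjunctions, with only `x`
  -- true, the value of a term tells whether `x` occurs in it.
  ∈Var-resp : DecidableEquality V → Regular E → ∀ {s t x} → E ⊢ s ≈ t → x ∈Var s → x ∈Var t
  ∈Var-resp _≟_ regular {s} {t} {x} s≈t x∈s =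
    let t-true       = trans (sym same) (occurrence⁺ is-x x∈s (dec-true (x ≟ x) refl))
        y , y∈t , eq = occurrence⁻ is-x t t-true
    in subst (_∈Var t) (sym (dec-true⁻ eq)) y∈t
    where
    is-x : V → Bool
    is-x y = does (x ≟ y)

    same = s≈t (occurrenceAlgebra S) (occurrenceAlgebra-model regular) is-x

    dec-true⁻ : ∀ {y} → does (x ≟ y) ≡ true → x ≡ y
    dec-true⁻ {y} eq with x ≟ y
    ... | yes x≡y = x≡y

module Theory {S : FiniteSignature} {V : Set} (E : Identities S V) where

  -- A record, so that s and t can be inferred from a proof of s ≋ t.
  record _≋_ (s t : Term S V) : Set₁ where
    constructor valid
    field holds : E ⊢ s ≈ t
  open _≋_ public

  infix 4 _≋_

  ≋-setoid : Setoid 0ℓ (lsuc 0ℓ)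
  ≋-setoid = record
    { Carrier       = Term S V
    ; _≈_           = _≋_
    ; isEquivalence = record
      { refl  = valid λ A _ _ → Algebra.refl A
      ; sym   = λ (valid p) → valid λ A m ρ → Algebra.sym A (p A m ρ)
      ; trans = λ (valid p) (valid q) → valid λ A m ρ → Algebra.trans A (p A m ρ) (q A m ρ)
      }
    }

  module ≋ = Setoid ≋-setoid

  -- A substitution is absorbed into the assignment, over which validity quantifies.
  bind-congˡ : ∀ m {s t} → s ≋ t → bind m s ≋ bind m t
  bind-congˡ m {s} {t} (valid p) = valid λ A model ρ →
    subst₂ (Algebra._≈_ A) (sym (eval-bind A ρ m s)) (sym (eval-bind A ρ m t))
      (p A model (eval A ρ ∘ m))

-- Instantiation

module Coded {S : FiniteSignature} {V : Set} (V↔ℕ : V ↔ ℕ) (E : Identities S V) where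

  open Theory E
  open ≈-Reasoning ≋-setoid

  code : V → ℕ
  code = Inverse.to V↔ℕ

  decode : ℕ → V
  decode = Inverse.from V↔ℕ

  decode-code : ∀ x → decode (code x) ≡ x
  decode-code = Inverse.strictlyInverseʳ V↔ℕ

  code-decode : ∀ j → code (decode j) ≡ j
  code-decode = Inverse.strictlyInverseˡ V↔ℕ

  code-injective : ∀ {x y} → code x ≡ code y → x ≡ y
  code-injective {x} {y} eq = trans (sym (decode-code x)) (trans (cong decode eq) (decode-code y))

  _≟_ : DecidableEquality V
  x ≟ y = map′ code-injective (cong code) (code x ≟ℕ code y)

  IdentityFrom : ℕ → (V → Term S V) → Set
  IdentityFrom N m = ∀ {x} → N ≤ code x → m x ≡ var x

  FiniteSupport : (V → Term S V) → Set
  FiniteSupport m = ∃ λ N → IdentityFrom N m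

  infix 4 _≲_
  record _≲_ (m m′ : V → Term S V) : Set₁ where
    constructor instance-by
    field
      l         : V → Term S V
      l-finite  : FiniteSupport l
      l-maps    : ∀ x → bind l (m x) ≋ m′ x

  ≲-refl : ∀ {m} → m ≲ m
  ≲-refl {m} = instance-by var (0 , λ _ → refl) λ x → ≋.reflexive (bind-var (m x))

  ≲-trans : ∀ {m₁ m₂ m₃} → m₁ ≲ m₂ → m₂ ≲ m₃ → m₁ ≲ m₃
  ≲-trans {m₁} {m₂} {m₃} (instance-by l (N , fin) eq) (instance-by l′ (N′ , fin′) eq′) =
    instance-by (bind l′ ∘ l)
    (N ⊔ N′ , λ {x} N⊔N′≤x →
      trans (cong (bind l′) (fin (m⊔n≤o⇒m≤o N N′ N⊔N′≤x))) (fin′ (m⊔n≤o⇒n≤o N N′ N⊔N′≤x)))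
    λ x → begin
      bind (bind l′ ∘ l) (m₁ x) ≡⟨ bind-bind l′ l (m₁ x) ⟨
      bind l′ (bind l (m₁ x))   ≈⟨ bind-congˡ l′ (eq x) ⟩
      bind l′ (m₂ x)            ≈⟨ eq′ x ⟩
      m₃ x                      ∎

  code-bound : (xs : List V) → ∃ λ N → ∀ {x} → x ∈ xs → code x < N
  code-bound []       = 0 , λ ()
  code-bound (x ∷ xs) =
    let N , bound = code-bound xs in
    suc (code x) ⊔ N , λ
      { (ListAny.here refl) → m≤m⊔n (suc (code x)) N
      ; (ListAny.there x∈)  → <-≤-trans (bound x∈) (m≤n⊔m (suc (code x)) N) }

  is-var? : ∀ (t : Term S V) x → Dec (t ≡ var x)
  is-var? (var y)    x = map′ (cong var) (λ { refl → refl }) (y ≟ x)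
  is-var? (node _ _) x = no λ ()

  map-finiteSupport : (σ : Substitution S V) → FiniteSupport (map σ)
  map-finiteSupport σ =
    let N , bound = code-bound (support σ) in
    N , λ {x} N≤x → decidable-stable (is-var? (map σ x) x) λ moved →
      <⇒≱ (bound (finiteDomain σ x moved)) N≤x

  InstPreorder⇒≲ : ∀ {σ τ} → InstPreorder E σ τ → map σ ≲ map τ
  InstPreorder⇒≲ {σ} {τ} (l , eq) = instance-by (map l) (map-finiteSupport l) λ x →
    valid (subst (λ t → E ⊢ t ≈ map τ x) (apply≡bind l (map σ x)) (eq x))

  variablesBelow : ℕ → List V
  variablesBelow N = List.map decode (upTo N)

  ∈-variablesBelow : ∀ {N x} → code x < N → x ∈ variablesBelow N
  ∈-variablesBelow {N} {x} x<N =
    subst (_∈ variablesBelow N) (decode-code x) (∈-map⁺ decode (∈-upTo⁺ x<N))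

  ≲⇒InstPreorder : ∀ {σ τ} → map σ ≲ map τ → InstPreorder E σ τ
  ≲⇒InstPreorder {σ} {τ} (instance-by l (N , fin) eq) = λ′ , λ x →
    subst (λ t → E ⊢ t ≈ map τ x) (sym (apply≡bind λ′ (map σ x))) (holds (eq x))
    where
    λ′ : Substitution S V
    λ′ = record
      { map          = l
      ; support      = variablesBelow N
      ; finiteDomain = λ x moved → ∈-variablesBelow (≰⇒> (moved ∘ fin))
      }

  mutual
    term-bound : (t : Term S V) → ∃ λ n → ∀ {y} → y ∈Var t → code y < n
    term-bound (var x)     = suc (code x) , λ { here → ≤-refl }
    term-bound (node f ts) = let n , bound = terms-bound ts in n , λ { (there y∈) → bound y∈ }

    terms-bound : ∀ {k} (ts : Vec (Term S V) k) → ∃ λ n → ∀ {y} → Any (y ∈Var_) ts → code y < n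
    terms-bound []       = 0 , λ ()
    terms-bound (t ∷ ts) =
      let n₁ , bound₁ = term-bound t
          n₂ , bound₂ = terms-bound ts
      in n₁ ⊔ n₂ , λ { (here y∈)  → <-≤-trans (bound₁ y∈) (m≤m⊔n n₁ n₂)
                     ; (there y∈) → <-≤-trans (bound₂ y∈) (m≤n⊔m n₁ n₂) }

  image-bound : ∀ (m : V → Term S V) N → ∃ λ n → ∀ {x y} → code x < N → y ∈Var m x → code y < n
  image-bound m zero    = 0 , λ ()
  image-bound m (suc N) =
    let n₁ , bound₁ = image-bound m N
        n₂ , bound₂ = term-bound (m (decode N))
    in n₁ ⊔ n₂ , λ {x} x<1+N y∈ →
      [ (λ x<N → <-≤-trans (bound₁ x<N y∈) (m≤m⊔n n₁ n₂))
      , (λ x≡N → <-≤-trans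
          (bound₂ (subst (λ z → _ ∈Var m z) (trans (sym (decode-code x)) (cong decode x≡N)) y∈))
          (m≤n⊔m n₁ n₂))
      ]′ (m<1+n⇒m<n∨m≡n x<1+N)

  Normal : ℕ → (V → Term S V) → Set
  Normal n m = ∀ {x y} → y ∈Var m x → code y < n ⊎ y ≡ x

  -- From `N` on, each image is the variable itself; below `N` there are finitely many images, whose
  -- variables have bounded codes.
  normal-bound : ∀ {m} → FiniteSupport m → ∃ λ n → IdentityFrom n m × Normal n m
  normal-bound {m} (N , fin) =
    let n , bound = image-bound m N in
    N ⊔ n ,
    (λ N⊔n≤x → fin (m⊔n≤o⇒m≤o N n N⊔n≤x)) ,
    λ {x} {y} y∈ → case (N ≤? code x) bound y∈
    where
    case : ∀ {n x y} → Dec (N ≤ code x) →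
           (∀ {x y} → code x < N → y ∈Var m x → code y < n) →
           y ∈Var m x → code y < N ⊔ n ⊎ y ≡ x
    case (yes N≤x) bound y∈ with subst (_ ∈Var_) (fin N≤x) y∈
    ... | here = inj₂ refl
    case {n} (no N≰x) bound y∈ = inj₁ (<-≤-trans (bound (≰⇒> N≰x) y∈) (m≤n⊔m N n))

  -- Transpositions of variables

  transpose : V → V → V → V
  transpose x y z with z ≟ x
  ... | yes _ = y
  ... | no  _ with z ≟ y
  ...   | yes _ = x
  ...   | no  _ = z

  transpose-ˡ : ∀ x y → transpose x y x ≡ y
  transpose-ˡ x y with x ≟ x
  ... | yes _   = refl
  ... | no  x≢x = contradiction refl x≢x

  transpose-ʳ : ∀ x y → transpose x y y ≡ x
  transpose-ʳ x y with y ≟ x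
  ... | yes y≡x = y≡x
  ... | no  _ with y ≟ y
  ...   | yes _   = refl
  ...   | no  y≢y = contradiction refl y≢y

  transpose-≢ : ∀ {x y z} → z ≢ x → z ≢ y → transpose x y z ≡ z
  transpose-≢ {x} {y} {z} z≢x z≢y with z ≟ x
  ... | yes z≡x = contradiction z≡x z≢x
  ... | no  _ with z ≟ y
  ...   | yes z≡y = contradiction z≡y z≢y
  ...   | no  _   = refl

  transpose-involutive : ∀ x y z → transpose x y (transpose x y z) ≡ z
  transpose-involutive x y z with z ≟ x
  ... | yes refl = transpose-ʳ x y
  ... | no  z≢x with z ≟ y
  ...   | yes refl = transpose-ˡ x y
  ...   | no  z≢y  = transpose-≢ z≢x z≢y

  transpose-finiteSupport : ∀ x y → IdentityFrom (suc (code x) ⊔ suc (code y)) (var ∘ transpose x y)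
  transpose-finiteSupport x y b≤z = cong var (transpose-≢
    (λ { refl → <-irrefl refl (m⊔n≤o⇒m≤o (suc (code x)) (suc (code y)) b≤z) })
    (λ { refl → <-irrefl refl (m⊔n≤o⇒n≤o (suc (code x)) (suc (code y)) b≤z) }))

  -- Renaming by a transposition is invertible, so the renamed map and the original are instances of
  -- each other.
  bind-transpose-involutive : ∀ x y (t : Term S V) →
                              bind (var ∘ transpose x y) (bind (var ∘ transpose x y) t) ≡ t
  bind-transpose-involutive x y t =
    trans (bind-bind _ _ t) (bind-fixes t λ {z} _ → cong var (transpose-involutive x y z))

  -- Normal forms relative to an anchor

  module Normalisation (regular : Regular E) {a : V → Term S V} {n : ℕ}
                       (a-id : IdentityFrom n a) (a-normal : Normal n a) where

    -- If n ≤ code x, then bind l (m′ x) ≋ var x, so l maps some variable of m′ x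
    -- to a term containing x; m is renamed until this variable is x itself.
    record Alignment (m : V → Term S V) (N j : ℕ) : Set₁ where
      field
        m′       : V → Term S V
        finite   : FiniteSupport m′
        to       : m ≲ m′
        from     : m′ ≲ m
        l        : V → Term S V
        l-id     : IdentityFrom N l
        l-eq     : ∀ x → bind l (m′ x) ≋ a x
        diagonal : ∀ {x} → n ≤ code x → code x < j → x ∈Var l x

    ∈Var-anchor : ∀ (m l : V → Term S V) → (∀ x → bind l (m x) ≋ a x) →
                  ∀ {x y z} → y ∈Var m x → z ∈Var l y → z ∈Var a x
    ∈Var-anchor m l eq {x} y∈ z∈ =
      ∈Var-resp _≟_ regular {bind l (m x)} {a x} (holds (eq x)) (∈Var-bind⁺ y∈ z∈)

    module _ {m N j} (j<N : j < N) (n≤j : n ≤ j) (A : Alignment m N j) where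
      open Alignment A

      private
        x : V
        x = decode j

        code-x : code x ≡ j
        code-x = code-decode j

        ax≡x : a x ≡ var x
        ax≡x = a-id (subst (n ≤_) (sym code-x) n≤j)

        -- `bind l (m′ x)` is equivalent to `var x`, so by regularity `x` occurs in it, hence in
        -- `l y` for some `y` of `m′ x`.
        pivot : ∃ λ y → y ∈Var m′ x × x ∈Var l y
        pivot = ∈Var-bind⁻ (m′ x)
          (∈Var-resp _≟_ regular (holds (≋.sym (l-eq x))) (subst (x ∈Var_) (sym ax≡x) here))

        y : V
        y = proj₁ pivot

        y∈ : y ∈Var m′ x
        y∈ = proj₁ (proj₂ pivot)

        x∈ : x ∈Var l y
        x∈ = proj₂ (proj₂ pivot)

        π : V → V
        π = transpose x y

        only-x : ∀ {z} → z ∈Var l y → z ≡ x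
        only-x z∈ with subst (_ ∈Var_) ax≡x (∈Var-anchor m′ l l-eq y∈ z∈)
        ... | here = refl

        l-id′ : IdentityFrom N (l ∘ π)
        l-id′ {z} N≤z = trans (cong l (transpose-≢ z≢x z≢y)) (l-id N≤z)
          where
          z≢x : z ≢ x
          z≢x refl = <⇒≱ j<N (subst (N ≤_) code-x N≤z)

          -- If `y` had code `N` or above, `l` would fix it; as `x` occurs in `l y`, then `y` would
          -- be `x`, whose code is `j < N`.
          z≢y : z ≢ y
          z≢y z≡y with subst (x ∈Var_) (trans (cong l (sym z≡y)) (l-id N≤z)) x∈
          ... | here = z≢x refl

        l-eq′ : ∀ z → bind (l ∘ π) (bind (var ∘ π) (m′ z)) ≋ a z
        l-eq′ z = begin
          bind (l ∘ π) (bind (var ∘ π) (m′ z))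
            ≡⟨ bind-bind (l ∘ π) (var ∘ π) (m′ z) ⟩
          bind (l ∘ π ∘ π) (m′ z)
            ≡⟨ bind-local (m′ z) (λ {w} _ → cong l (transpose-involutive x y w)) ⟩
          bind l (m′ z)
            ≈⟨ l-eq z ⟩
          a z
            ∎

        diagonal′ : ∀ {z} → n ≤ code z → code z < suc j → z ∈Var l (π z)
        diagonal′ {z} n≤z z<1+j = case (z ≟ x)
          where
          case : Dec (z ≡ x) → z ∈Var l (π z)
          case (yes z≡x) = subst (λ z → z ∈Var l (π z)) (sym z≡x)
            (subst (λ w → x ∈Var l w) (sym (transpose-ˡ x y)) x∈)
          case (no z≢x) = subst (λ w → z ∈Var l w) (sym (transpose-≢ z≢x z≢y)) z∈
            where
            z∈ : z ∈Var l z
            z∈ = diagonal n≤z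
              (≤∧≢⇒< (s≤s⁻¹ z<1+j) λ eq → z≢x (code-injective (trans eq (sym code-x))))

            -- `l y` contains only `x`, so a previously aligned `z` differs from `y` and the swap
            -- leaves it in place.
            z≢y : z ≢ y
            z≢y z≡y = z≢x (only-x (subst (λ w → z ∈Var l w) z≡y z∈))

        π-finite : FiniteSupport (var ∘ π)
        π-finite = _ , transpose-finiteSupport x y

        m″-finite : FiniteSupport (bind (var ∘ π) ∘ m′)
        m″-finite =
          let M , fin = finite
              K , π-fin = π-finite
          in M ⊔ K , λ M⊔K≤z →
            trans (cong (bind (var ∘ π)) (fin (m⊔n≤o⇒m≤o M K M⊔K≤z)))
                  (π-fin (m⊔n≤o⇒n≤o M K M⊔K≤z))

      align-next : Alignment m N (suc j)
      align-next = record
        { m′       = bind (var ∘ π) ∘ m′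
        ; finite   = m″-finite
        ; to       = ≲-trans to (instance-by (var ∘ π) π-finite λ _ → ≋.refl)
        ; from     = ≲-trans
            (instance-by (var ∘ π) π-finite λ z →
              ≋.reflexive (bind-transpose-involutive x y (m′ z))) from
        ; l        = l ∘ π
        ; l-id     = l-id′
        ; l-eq     = l-eq′
        ; diagonal = diagonal′
        }

    align : ∀ {m l N} → FiniteSupport m → IdentityFrom N l → (∀ x → bind l (m x) ≋ a x) →
            ∀ j → j ≤ N → Alignment m N j
    align {m} {l} finite l-id l-eq zero j≤N = record
      { m′       = m
      ; finite   = finite
      ; to       = ≲-refl
      ; from     = ≲-refl
      ; l        = l
      ; l-id     = l-id
      ; l-eq     = l-eq
      ; diagonal = λ _ ()
      }
    align finite l-id l-eq (suc j) j<N with align finite l-id l-eq j (<⇒≤ j<N) | n ≤? j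
    ... | A | yes n≤j = align-next j<N n≤j A
    ... | A | no  n≰j = record
      { Alignment A
      ; diagonal = λ n≤x x<1+j → contradiction (≤-trans n≤x (s≤s⁻¹ x<1+j)) n≰j
      }

    normalise : ∀ {m} → FiniteSupport m → m ≲ a →
                ∃ λ m′ → FiniteSupport m′ × m ≲ m′ × m′ ≲ m × Normal n m′
    normalise {m} finite (instance-by l₀ (N , l₀-id) l₀-eq) = m′ , finite′ , to , from , normal
      where
      open Alignment (align finite l₀-id l₀-eq N ≤-refl) renaming (finite to finite′)

      diagonal-all : ∀ {x} → n ≤ code x → x ∈Var l x
      diagonal-all {x} n≤x with N ≤? code x
      ... | yes N≤x = subst (x ∈Var_) (sym (l-id N≤x)) here
      ... | no  N≰x = diagonal n≤x (≰⇒> N≰x)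

      normal : Normal n m′
      normal {x} {y} y∈ with n ≤? code y
      -- `y` occurs in `l y` and therefore in `a x`, which is normal.
      ... | yes n≤y = a-normal (∈Var-anchor m′ l l-eq y∈ (diagonal-all n≤y))
      ... | no  n≰y = inj₁ (≰⇒> n≰y)

  -- Colours from local finiteness

  cutoff : ℕ → V → V → V
  cutoff n z y with n ≤? code y
  ... | yes _ = z
  ... | no  _ = y

  cutoff-< : ∀ {n z y} → code y < n → cutoff n z y ≡ y
  cutoff-< {n} {z} {y} y<n with n ≤? code y
  ... | yes n≤y = contradiction n≤y (<⇒≱ y<n)
  ... | no  _   = refl

  cutoff-≥ : ∀ {n z y} → n ≤ code y → cutoff n z y ≡ z
  cutoff-≥ {n} {z} {y} n≤y with n ≤? code y
  ... | yes _   = refl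
  ... | no  n≰y = contradiction n≤y n≰y

  -- Variables of T τ with code n or above are placeholders for x.
  Coloured : ∀ {K} → ℕ → (Fin K → Term S V) → (ℕ → Fin K) → (V → Term S V) → Set₁
  Coloured n T c m = ∀ x → m x ≋ bind (var ∘ cutoff n x) (T (c (code x)))

  -- The variables below `n` and `decode n`, the placeholder, suffice. As `T` is chosen before `m`,
  -- equal colours of two maps at the same variable give equivalent terms.
  colouring : LocallyFinite E → ∀ n →
              ∃₂ λ K (T : Fin K → Term S V) → ∀ {m} → Normal n m → ∃ λ c → Coloured n T c m
  colouring locallyFinite n = _ , T , λ {m} normal → c normal , coloured normal
    where
    classesₙ = classes E (variablesBelow (suc n))
    reps     = proj₁ (locallyFinite (variablesBelow (suc n)))
    enum     = proj₂ (locallyFinite (variablesBelow (suc n)))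

    T : Fin (List.length reps) → Term S V
    T = proj₁ ∘ List.lookup reps

    collapse : V → V
    collapse = cutoff n (decode n)

    collapse-below : ∀ y → code (collapse y) < suc n
    collapse-below y with n ≤? code y
    ... | yes _   = s≤s (≤-reflexive (code-decode n))
    ... | no  n≰y = ≤-trans (≰⇒> n≰y) (n≤1+n n)

    collapsed : Term S V → TermOver {S} (variablesBelow (suc n))
    collapsed t = bind (var ∘ collapse) t , λ y y∈ → ∈-variablesBelow (below (∈Var-bind⁻ t y∈))
      where
      below : ∀ {y} → (∃ λ x → x ∈Var t × y ∈Var var (collapse x)) → code y < suc n
      below (x , _ , here) = collapse-below x

    c : ∀ {m} → Normal n m → ℕ → Fin (List.length reps)
    c {m} _ j = ListAny.index (enum (collapsed (m (decode j))))

    -- By normality a variable of `m x` with code `n` or above can only be `x`, so the placeholder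
    -- loses no information.
    restore : ∀ {m} → Normal n m → ∀ {x y} → y ∈Var m x → cutoff n x (collapse y) ≡ y
    restore normal {x} {y} y∈ with n ≤? code y
    ... | no  n≰y = cutoff-< (≰⇒> n≰y)
    ... | yes n≤y with normal y∈
    ...   | inj₁ y<n  = contradiction n≤y (<⇒≱ y<n)
    ...   | inj₂ refl = cutoff-≥ (≤-reflexive (sym (code-decode n)))

    coloured : ∀ {m} (normal : Normal n m) → Coloured n T (c normal) m
    coloured {m} normal x = begin
      m x
        ≡⟨ bind-fixes (m x) (cong var ∘ restore normal) ⟨
      bind (var ∘ cutoff n x ∘ collapse) (m x)
        ≡⟨ bind-bind (var ∘ cutoff n x) (var ∘ collapse) (m x) ⟨
      bind (var ∘ cutoff n x) (bind (var ∘ collapse) (m x))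
        ≡⟨ cong (λ z → bind (var ∘ cutoff n x) (bind (var ∘ collapse) (m z))) (decode-code x) ⟨
      bind (var ∘ cutoff n x) (bind (var ∘ collapse) (m (decode (code x))))
        ≈⟨ bind-congˡ (var ∘ cutoff n x) (represented (decode (code x))) ⟩
      bind (var ∘ cutoff n x) (T (c normal (code x)))
        ∎
      where
      represented : ∀ y → bind (var ∘ collapse) (m y) ≋
                          T (ListAny.index (enum (collapsed (m y))))
      represented y = valid (lookup-index (enum (collapsed (m y))))

  -- Reversing an instance between coloured maps

  module _ {K n} {T : Fin K → Term S V} {c c′ : ℕ → Fin K} {m m′ : V → Term S V} {ℓ ℓ′ : ℕ}
           (m-normal : Normal n m) (m′-normal : Normal n m′)
           (m-coloured : Coloured n T c m) (m′-coloured : Coloured n T c′ m′)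
           (m-id : IdentityFrom ℓ m) (m′-id : IdentityFrom ℓ′ m′) where

    -- Here `m` is σᵢ and `m′` is σₖ. Below `b` the two maps agree up to equivalence; from `b` to
    -- `ℓ` a variable is routed through `f`; from `b ⊔ ℓ` on, `m` is the identity and `l′` copies
    -- `m′`.
    transfer-≲ : m′ ≲ m → Transfer n c ℓ c′ ℓ′ → m ≲ m′
    transfer-≲ (instance-by l _ l-eq) tr = instance-by l′ (b ⊔ ℓ ⊔ ℓ′ , l′-id) l′-eq
      where
      open Transfer tr

      f g : V → V
      f = decode ∘ to ∘ code
      g = decode ∘ from ∘ code

      -- Off the image of `f`, the values from `b ⊔ ℓ` on are arbitrary: only `θ-low` and `θ-f`
      -- enter the equations. The finite support of `l′` comes from `m′`.
      θ : V → Term S V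
      θ y with b ⊔ ℓ ≤? code y
      ... | yes _ = m′ (g y)
      ... | no  _ = var y

      θ-low : ∀ {y} → code y < b → θ y ≡ var y
      θ-low {y} y<b with b ⊔ ℓ ≤? code y
      ... | yes b⊔ℓ≤y = contradiction (m⊔n≤o⇒m≤o b ℓ b⊔ℓ≤y) (<⇒≱ y<b)
      ... | no  _     = refl

      θ-f : ∀ {x} → b ≤ code x → code x < ℓ → θ (f x) ≡ m′ x
      θ-f {x} b≤x x<ℓ with b ⊔ ℓ ≤? code (f x)
      ... | yes _ = cong m′ (trans
        (cong decode (trans (cong from (code-decode (to (code x)))) (from-to b≤x x<ℓ)))
        (decode-code x))
      ... | no ≰ = contradiction
        (subst (b ⊔ ℓ ≤_) (sym (code-decode (to (code x)))) (to-lower b≤x x<ℓ)) ≰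

      l′ : V → Term S V
      l′ y with b ≤? code y | ℓ ≤? code y
      ... | no  _ | _     = bind θ (l y)
      ... | yes _ | no  _ = bind θ (l (f y))
      ... | yes _ | yes _ = m′ y

      l′-low : ∀ {y} → code y < b → l′ y ≡ bind θ (l y)
      l′-low {y} y<b with b ≤? code y | ℓ ≤? code y
      ... | no  _   | _ = refl
      ... | yes b≤y | _ = contradiction b≤y (<⇒≱ y<b)

      l′-mid : ∀ {y} → b ≤ code y → code y < ℓ → l′ y ≡ bind θ (l (f y))
      l′-mid {y} b≤y y<ℓ with b ≤? code y | ℓ ≤? code y
      ... | no  b≰y | _       = contradiction b≤y b≰y
      ... | yes _   | no  _   = refl
      ... | yes _   | yes ℓ≤y = contradiction ℓ≤y (<⇒≱ y<ℓ)

      l′-high : ∀ {y} → b ≤ code y → ℓ ≤ code y → l′ y ≡ m′ y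
      l′-high {y} b≤y ℓ≤y with b ≤? code y | ℓ ≤? code y
      ... | no  b≰y | _       = contradiction b≤y b≰y
      ... | yes _   | no  ℓ≰y = contradiction ℓ≤y ℓ≰y
      ... | yes _   | yes _   = refl

      l′-id : IdentityFrom (b ⊔ ℓ ⊔ ℓ′) l′
      l′-id {x} ≤x =
        let b⊔ℓ≤x = m⊔n≤o⇒m≤o (b ⊔ ℓ) ℓ′ ≤x in
        trans (l′-high (m⊔n≤o⇒m≤o b ℓ b⊔ℓ≤x) (m⊔n≤o⇒n≤o b ℓ b⊔ℓ≤x))
              (m′-id (m⊔n≤o⇒n≤o (b ⊔ ℓ) ℓ′ ≤x))

      vars-low : ∀ {p} → Normal n p → ∀ {x y} → code x < b → y ∈Var p x → code y < b
      vars-low normal x<b y∈ with normal y∈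
      ... | inj₁ y<n  = <-≤-trans y<n n≤b
      ... | inj₂ refl = x<b

      eq-low : ∀ {x} → code x < b → bind l′ (m x) ≋ m′ x
      eq-low {x} x<b = begin
        bind l′ (m x)            ≈⟨ bind-congˡ l′ mx≋m′x ⟩
        -- All variables of `m′ x` have codes below `b`, where `l′` is `θ` after `l`. Those of `m x`
        -- do too, so `θ` disappears at the end.
        bind l′ (m′ x)           ≡⟨ bind-local (m′ x) (l′-low ∘ vars-low m′-normal x<b) ⟩
        bind (bind θ ∘ l) (m′ x) ≡⟨ bind-bind θ l (m′ x) ⟨
        bind θ (bind l (m′ x))   ≈⟨ bind-congˡ θ (l-eq x) ⟩
        bind θ (m x)             ≡⟨ bind-fixes (m x) (θ-low ∘ vars-low m-normal x<b) ⟩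
        m x                      ≈⟨ mx≋m′x ⟩
        m′ x                     ∎
        where
        mx≋m′x : m x ≋ m′ x
        mx≋m′x = begin
          m x
            ≈⟨ m-coloured x ⟩
          bind (var ∘ cutoff n x) (T (c (code x)))
            ≡⟨ cong (bind (var ∘ cutoff n x) ∘ T) (agree (code x) x<b) ⟩
          bind (var ∘ cutoff n x) (T (c′ (code x)))
            ≈⟨ m′-coloured x ⟨
          m′ x
            ∎

      eq-mid : ∀ {x} → b ≤ code x → code x < ℓ → bind l′ (m x) ≋ m′ x
      eq-mid {x} b≤x x<ℓ = begin
        bind l′ (m x)
          ≈⟨ bind-congˡ l′ (m-coloured x) ⟩
        bind l′ (bind (var ∘ cutoff n x) t)
          ≡⟨ bind-bind l′ (var ∘ cutoff n x) t ⟩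
        bind (l′ ∘ cutoff n x) t
          ≡⟨ bind-local t (λ {y} _ → shifted y) ⟩
        -- Below `n`, `l′` is `θ` after `l`; at `x` it takes the value that this composite has at
        -- `f x`. So the placeholder may be moved from `x` to `f x`, and equality of colours then
        -- yields `m′ (f x)`.
        bind (bind θ ∘ l ∘ cutoff n (f x)) t
          ≡⟨ bind-bind (bind θ ∘ l) (var ∘ cutoff n (f x)) t ⟨
        bind (bind θ ∘ l) (bind (var ∘ cutoff n (f x)) t)
          ≡⟨ bind-bind θ l (bind (var ∘ cutoff n (f x)) t) ⟨
        bind θ (bind l (bind (var ∘ cutoff n (f x)) t))
          ≡⟨ cong (bind θ ∘ bind l ∘ bind (var ∘ cutoff n (f x)) ∘ T) same-colour ⟨
        bind θ (bind l (bind (var ∘ cutoff n (f x)) (T (c′ (code (f x))))))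
          ≈⟨ bind-congˡ θ (bind-congˡ l (m′-coloured (f x))) ⟨
        bind θ (bind l (m′ (f x)))
          ≈⟨ bind-congˡ θ (l-eq (f x)) ⟩
        bind θ (m (f x))
          ≡⟨ cong (bind θ) (m-id ℓ≤fx) ⟩
        θ (f x)
          ≡⟨ θ-f b≤x x<ℓ ⟩
        m′ x
          ∎
        where
        t : Term S V
        t = T (c (code x))

        same-colour : c′ (code (f x)) ≡ c (code x)
        same-colour = trans (cong c′ (code-decode (to (code x)))) (to-colour b≤x x<ℓ)

        ℓ≤fx : ℓ ≤ code (f x)
        ℓ≤fx = subst (ℓ ≤_) (sym (code-decode (to (code x))))
          (m⊔n≤o⇒n≤o b ℓ (to-lower b≤x x<ℓ))

        shifted : ∀ y → l′ (cutoff n x y) ≡ bind θ (l (cutoff n (f x) y))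
        shifted y with n ≤? code y
        ... | yes _   = l′-mid b≤x x<ℓ
        ... | no  n≰y = l′-low (<-≤-trans (≰⇒> n≰y) n≤b)

      l′-eq : ∀ x → bind l′ (m x) ≋ m′ x
      l′-eq x with b ≤? code x | ℓ ≤? code x
      ... | no  b≰x | _       = eq-low (≰⇒> b≰x)
      ... | yes b≤x | no  ℓ≰x = eq-mid b≤x (≰⇒> ℓ≰x)
      ... | yes b≤x | yes ℓ≤x = ≋.reflexive (trans (cong (bind l′) (m-id ℓ≤x)) (l′-high b≤x ℓ≤x))

  -- Contradiction from a descending chain

  noetherian : Regular E → LocallyFinite E → Noetherian E
  noetherian regular locallyFinite (f , descending) =
    transferable-pair n c ℓ λ (i , k , i<k , tr) →
      -- The links `f i ≲ m i ≲ m k ≲ f k ≲ f (suc i)` contradict strictness at `i`; the last one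
      -- reads `i<k` as `suc i ≤ k`.
      proj₂ (descending i) (≲⇒InstPreorder {f i} {f (suc i)}
        (≲-trans (to i) (≲-trans (pair-≲ (<⇒≤ i<k) tr) (≲-trans (from k) (chain i<k)))))
    where
    chain : ∀ {i k} → i ≤ k → map (f k) ≲ map (f i)
    chain = go ∘ ≤⇒≤′
      where
      go : ∀ {i k} → i ≤′ k → map (f k) ≲ map (f i)
      go ≤′-refl        = ≲-refl
      go (≤′-step {n = k} i≤′k) =
        ≲-trans (InstPreorder⇒≲ {f (suc k)} {f k} (proj₁ (descending k))) (go i≤′k)

    -- Every `f k` lies below `f 0`, so a single `n`, and with it a single set of colours, serves
    -- the whole chain.
    anchor = normal-bound (map-finiteSupport (f 0))
    n      = proj₁ anchor

    open Normalisation regular (proj₁ (proj₂ anchor)) (proj₂ (proj₂ anchor))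

    normalised : ∀ k → ∃ λ m → FiniteSupport m × map (f k) ≲ m × m ≲ map (f k) × Normal n m
    normalised k = normalise (map-finiteSupport (f k)) (chain z≤n)

    m : ℕ → V → Term S V
    m k = proj₁ (normalised k)

    ℓ : ℕ → ℕ
    ℓ k = proj₁ (proj₁ (proj₂ (normalised k)))

    m-id : ∀ k → IdentityFrom (ℓ k) (m k)
    m-id k = proj₂ (proj₁ (proj₂ (normalised k)))

    to : ∀ k → map (f k) ≲ m k
    to k = proj₁ (proj₂ (proj₂ (normalised k)))

    from : ∀ k → m k ≲ map (f k)
    from k = proj₁ (proj₂ (proj₂ (proj₂ (normalised k))))

    normal : ∀ k → Normal n (m k)
    normal k = proj₂ (proj₂ (proj₂ (proj₂ (normalised k))))

    colours = colouring locallyFinite n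

    c : ℕ → ℕ → Fin (proj₁ colours)
    c k = proj₁ (proj₂ (proj₂ colours) (normal k))

    coloured : ∀ k → Coloured n (proj₁ (proj₂ colours)) (c k) (m k)
    coloured k = proj₂ (proj₂ (proj₂ colours) (normal k))

    pair-≲ : ∀ {i k} → i ≤ k → Transfer n (c i) (ℓ i) (c k) (ℓ k) → m i ≲ m k
    pair-≲ {i} {k} i≤k = transfer-≲ {T = proj₁ (proj₂ colours)} (normal i) (normal k)
      (coloured i) (coloured k) (m-id i) (m-id k)
      (≲-trans (from k) (≲-trans (chain i≤k) (to i)))

proposition6p11 : (S : FiniteSignature) (V : Set) → V ↔ ℕ →
    (E : Identities S V) →
    NonTrivial E → Regular E → LocallyFinite E →
    Noetherian E
proposition6p11 S V V↔ℕ E _ = Coded.noetherian V↔ℕ E
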